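{- Let $G$ and $H$ be groups and $f:G\to H$ a function such that for all $x,x'\in G$ there is $h\in H$ (depending on $x,x'$) with $f(xx')=f(x)^h\,f(x')$. Let $G_0$, $G_1$ be groups, $f_0:G_0\to H$ and $f_1:G_1\to H$ functions, $c\in H$, and $k\ge2$ an integer. If the set $\{(x_0,x,x_1)\in G_0\times G\times G_1: f_0(x_0)\,f(x)\,f_1(x_1)=c\}$ is $k$-large in $G_0\times G\times G_1$, then $f(g)=1$ for all $g\in G$, and the set $\{(x_0,x_1)\in G_0\times G_1:f_0(x_0)\,f_1(x_1)=c\}$ is $k$-large in $G_0\times G_1$.
   Context: $a^h=h^{ -1}ah$. A subset $X$ of a group $K$ is $k$-large in $K$ if the intersection of any $k$ left translates $a_1X\cap\dots\cap a_kX$ ($a_i\in K$) is non-empty. -}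

module Defs where

open import Algebra.Bundles using (Group)
open import Data.Fin.Base using (Fin)
open import Data.Nat.Base using (ℕ)
open import Data.Product.Base using (∃; _×_)
open import Level using (Level; _⊔_)
open import Relation.Unary using (Pred; _∈_; ⋂; Satisfiable)

module _ {c ℓ : Level} (K : Group c ℓ) where
  open Group K

  conjugate : Carrier → Carrier → Carrier
  conjugate a h = h ⁻¹ ∙ a ∙ h

  -- Closed under _≈_ even when X is not.
  leftTranslate : ∀ {p} → Carrier → Pred Carrier p → Pred Carrier (c ⊔ ℓ ⊔ p)
  leftTranslate a X y = ∃ λ x → x ∈ X × y ≈ a ∙ x

  -- The elements a i need not be distinct.
  Large : ∀ {p} → ℕ → Pred Carrier p → Set (c ⊔ ℓ ⊔ p)
  Large k X = (a : Fin k → Carrier) →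
    Satisfiable (⋂ (Fin k) λ i → leftTranslate (a i) X)

{-# OPTIONS --safe #-}

-- Translating only in the G-coordinate, by 1 and by g, gives two solutions that
-- differ only there, x and g x; cancelling f₀ and f₁ yields f (g x) = f x, so
-- some conjugate of f g is trivial.

module Submission where

open import Defs
open import Algebra.Bundles using (Group)
open import Algebra.Construct.DirectProduct using (group)
import Algebra.Properties.Group as GroupProperties
open import Data.Fin.Base using (zero; suc)
open import Data.Nat.Base using (ℕ; _≤_; s≤s)
open import Data.Product.Base using (∃; _×_; _,_)
open import Function.Bundles using (Func)
open import Level using (Level)
import Relation.Binary.Reasoning.Setoid as SetoidReasoning

-- Intersecting the solution set with its translate by `g` in the middle coordinate gives solutions
-- with equal outer coordinates and middle coordinates `x′` and `g x′`. Cancellation in `H` gives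
-- `f (g x′) = f x′`, while the twisted product rule gives `f (g x′) = f(g)^h f(x′)`. Hence
-- `f(g)^h = 1`, so `f g = 1`. Once `f` is trivial the middle factor vanishes from the equation, and
-- largeness projects to `G₀ × G₁`.

module _ {c ℓ : Level} (K : Group c ℓ) where
  open Group K
  open GroupProperties K

  conjugate≈ε⇒≈ε : ∀ a h → conjugate K a h ≈ ε → a ≈ ε
  conjugate≈ε⇒≈ε a h eq = identityʳ-unique (h ⁻¹) a
    (inverseˡ-unique (h ⁻¹ ∙ a) h eq)

  ∙-cancel-outer : ∀ {a a′ b b′ x y} → a ≈ a′ → b ≈ b′ →
    a ∙ x ∙ b ≈ a′ ∙ y ∙ b′ → x ≈ y
  ∙-cancel-outer {a} {a′} {b} {b′} {x} {y} a≈a′ b≈b′ eq =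
    ∙-cancelˡ a x y (∙-cancelʳ b (a ∙ x) (a ∙ y)
      (trans eq (sym (∙-cong (∙-congʳ a≈a′) b≈b′))))

  ε∙-injective : ∀ {x y z} → z ≈ ε ∙ x → z ≈ ε ∙ y → x ≈ y
  ε∙-injective {x} {y} p q = ∙-cancelˡ ε x y (trans (sym p) q)

theorem5p1 :
  ∀ {g ℓ h ℓ′ g₀ ℓ₀ g₁ ℓ₁ : Level}
  (G : Group g ℓ) (H : Group h ℓ′) (G₀ : Group g₀ ℓ₀) (G₁ : Group g₁ ℓ₁) →
  let module G = Group G
      module H = Group H
      module G₀ = Group G₀
      module G₁ = Group G₁
  in
  (F : Func G.setoid H.setoid) (F₀ : Func G₀.setoid H.setoid) (F₁ : Func G₁.setoid H.setoid) →
  let f = Func.to F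
      f₀ = Func.to F₀
      f₁ = Func.to F₁
  in
  (∀ x x′ → ∃ λ h → f (x G.∙ x′) H.≈ conjugate H (f x) h H.∙ f x′) →
  (c : H.Carrier) (k : ℕ) → 2 ≤ k →
  Large (group G₀ (group G G₁)) k (λ (x₀ , x , x₁) → f₀ x₀ H.∙ f x H.∙ f₁ x₁ H.≈ c) →
  (∀ g → f g H.≈ H.ε) ×
  Large (group G₀ G₁) k (λ (x₀ , x₁) → f₀ x₀ H.∙ f₁ x₁ H.≈ c)
theorem5p1 G H G₀ G₁ F F₀ F₁ f-∙ c k 2≤k large = f≈ε 2≤k large , large′
  where
  module G = Group G
  module H = Group H
  module G₀ = Group G₀
  module G₁ = Group G₁
  open Func F using () renaming (to to f; cong to f-cong)
  open Func F₀ using () renaming (to to f₀; cong to f₀-cong)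
  open Func F₁ using () renaming (to to f₁; cong to f₁-cong)
  open SetoidReasoning H.setoid

  -- Quantifying over `k` afresh lets the match on `2 ≤ k` expose the two indices `zero` and
  -- `suc zero`.
  f≈ε : ∀ {k} → 2 ≤ k →
    Large (group G₀ (group G G₁)) k (λ (x₀ , x , x₁) → f₀ x₀ H.∙ f x H.∙ f₁ x₁ H.≈ c) →
    ∀ g → f g H.≈ H.ε
  f≈ε (s≤s (s≤s _)) large g
    -- Indices 0 and 1 receive the two translates to be compared; any later index repeats the
    -- second.
    with large (λ { zero → G₀.ε , G.ε , G₁.ε ; (suc _) → G₀.ε , g , G₁.ε })
  ... | _ , y∈
    with y∈ zero | y∈ (suc zero)
  ... | (x₀ , x , x₁) , x∈X , (p₀ , p , p₁) | (x₀′ , x′ , x₁′) , x′∈X , (p₀′ , p′ , p₁′)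
    with h , fgx′ ← f-∙ g x′ =
    conjugate≈ε⇒≈ε H (f g) h (identityˡ-unique _ (f x′) (begin
      conjugate H (f g) h H.∙ f x′ ≈⟨ fgx′ ⟨
      f (g G.∙ x′)                 ≈⟨ f-cong (G.trans (G.sym p′) (G.trans p (G.identityˡ x))) ⟩
      -- Both solutions have the outer coordinates of the common point, since these are translated
      -- by `ε` only.
      f x                          ≈⟨ ∙-cancel-outer H
                                        (f₀-cong (ε∙-injective G₀ p₀ p₀′))
                                        (f₁-cong (ε∙-injective G₁ p₁ p₁′))
                                        (H.trans x∈X (H.sym x′∈X)) ⟩
      f x′                         ∎))
    where open GroupProperties H using (identityˡ-unique)

  large′ : Large (group G₀ G₁) k (λ (x₀ , x₁) → f₀ x₀ H.∙ f₁ x₁ H.≈ c)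
  large′ a
    -- Each translate is lifted with `ε` in the middle, and the common point is then projected to
    -- its outer coordinates.
    with (y₀ , _ , y₁) , y∈ ← large (λ i → let (a₀ , a₁) = a i in a₀ , G.ε , a₁) =
    (y₀ , y₁) , λ i → let ((x₀ , x , x₁) , x∈X , (p₀ , _ , p₁)) = y∈ i in
    (x₀ , x₁) , (begin
      f₀ x₀ H.∙ f₁ x₁           ≈⟨ H.∙-congʳ (H.identityʳ (f₀ x₀)) ⟨
      f₀ x₀ H.∙ H.ε H.∙ f₁ x₁   ≈⟨ H.∙-congʳ (H.∙-congˡ (f≈ε 2≤k large x)) ⟨
      f₀ x₀ H.∙ f x H.∙ f₁ x₁   ≈⟨ x∈X ⟩
      c                         ∎) , (p₀ , p₁)
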